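{- Every $1$-Sperner hypergraph ${\cal H}=(V,{\cal E})$ with $V\neq\emptyset$ is $1$-decomposable, that is, it is the gluing of two $1$-Sperner hypergraphs.
   Context: A hypergraph ${\cal H}=(V,{\cal E})$ consists of a finite vertex set $V$ and a set ${\cal E}$ of subsets of $V$. It is $1$-Sperner if every two distinct hyperedges $e,f$ satisfy $\min\{|e\setminus f|,|f\setminus e|\}=1$. Given vertex-disjoint hypergraphs ${\cal H}_1=(V_1,{\cal E}_1)$, ${\cal H}_2=(V_2,{\cal E}_2)$ and a new vertex $z\notin V_1\cup V_2$, the gluing ${\cal H}_1\odot{\cal H}_2$ has vertex set $V_1\cup V_2\cup\{z\}$ and hyperedge set $\{\{z\}\cup e: e\in{\cal E}_1\}\cup\{V_1\cup e: e\in{\cal E}_2\}$. ${\cal H}$ is $z$-decomposable for a vertex $z$ if for all hyperedges $e,f$ with $z\in e\setminus f$ we have $e\setminus\{z\}\subseteq f$ (equivalently ${\cal H}$ is a gluing with new vertex $z$), and $1$-decomposable if it is $z$-decomposable for some vertex $z$. -}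

module Defs where

open import Level using (0ℓ)
open import Data.Bool.Properties using () renaming (_≟_ to _≟ᵇ_)
open import Data.Fin.Base using (Fin)
open import Data.Fin.Subset
  using (Subset; _∈_; _∉_; _⊆_; _∪_; _∩_; _─_; _-_; ⁅_⁆; ∣_∣; Empty)
open import Data.Fin.Subset.Properties using (anySubset?; p⊆p∪q; q⊆p∪q; x∈p∪q⁻)
open import Data.Nat.Base using (ℕ; _⊓_)
open import Data.Product.Base using (_×_; _,_; ∃-syntax)
open import Data.Sum.Base using (_⊎_; inj₁; inj₂; [_,_]′)
open import Data.Vec.Properties using (≡-dec)
open import Function.Base using (_∘_)
open import Relation.Binary.PropositionalEquality.Core using (_≡_; _≢_; refl)
open import Relation.Nullary.Decidable using (_×-dec_; _⊎-dec_)
open import Relation.Unary using (Pred; Decidable; _≐_)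

private
  variable
    n : ℕ

-- The vertex set V is an arbitrary subset of an ambient finite set Fin n, so
-- that vertex-disjoint hypergraphs and new vertices can be spoken of directly.
-- A (finite) set of hyperedges is a decidable predicate on subsets of Fin n.

record Hypergraph (n : ℕ) : Set₁ where
  field
    V    : Subset n
    Edge : Pred (Subset n) 0ℓ
    Edge? : Decidable Edge
    Edge⇒⊆V : ∀ {e} → Edge e → e ⊆ V

open Hypergraph public

-- Extensional equality: the same vertices and the same hyperedges.

infix 4 _≈_

_≈_ : Hypergraph n → Hypergraph n → Set
H ≈ K = V H ≡ V K × Edge H ≐ Edge K

OneSperner : Hypergraph n → Set
OneSperner H = ∀ e f → Edge H e → Edge H f → e ≢ f → ∣ e ─ f ∣ ⊓ ∣ f ─ e ∣ ≡ 1

-- Defined for all arguments, but only meaningful under Gluable z H₁ H₂.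

glue : Fin n → Hypergraph n → Hypergraph n → Hypergraph n
glue {n} z H₁ H₂ = record
  { V       = V H₁ ∪ V H₂ ∪ ⁅ z ⁆
  ; Edge    = λ f → (∃[ e ] Edge H₁ e × f ≡ ⁅ z ⁆ ∪ e)
                  ⊎ (∃[ e ] Edge H₂ e × f ≡ V H₁ ∪ e)
  ; Edge?   = λ f → anySubset? (λ e → Edge? H₁ e ×-dec ≡-dec _≟ᵇ_ f (⁅ z ⁆ ∪ e))
                ⊎-dec anySubset? (λ e → Edge? H₂ e ×-dec ≡-dec _≟ᵇ_ f (V H₁ ∪ e))
  ; Edge⇒⊆V = λ where
      (inj₁ (e , e∈E₁ , refl)) →
        [ inV₂z ∘ q⊆p∪q (V H₂) ⁅ z ⁆ , inV₁ ∘ Edge⇒⊆V H₁ e∈E₁ ]′ ∘ x∈p∪q⁻ ⁅ z ⁆ e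
      (inj₂ (e , e∈E₂ , refl)) →
        [ inV₁ , inV₂z ∘ p⊆p∪q ⁅ z ⁆ ∘ Edge⇒⊆V H₂ e∈E₂ ]′ ∘ x∈p∪q⁻ (V H₁) e
  }
  where
  inV₁ : V H₁ ⊆ V H₁ ∪ V H₂ ∪ ⁅ z ⁆
  inV₁ = p⊆p∪q (V H₂ ∪ ⁅ z ⁆)

  inV₂z : V H₂ ∪ ⁅ z ⁆ ⊆ V H₁ ∪ V H₂ ∪ ⁅ z ⁆
  inV₂z = q⊆p∪q (V H₁) (V H₂ ∪ ⁅ z ⁆)

Gluable : Fin n → Hypergraph n → Hypergraph n → Set
Gluable z H₁ H₂ = Empty (V H₁ ∩ V H₂) × z ∉ V H₁ ∪ V H₂

Decomposable : Fin n → Hypergraph n → Set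
Decomposable z H = ∀ e f → Edge H e → Edge H f → z ∈ e ─ f → e - z ⊆ f

OneDecomposable : Hypergraph n → Set
OneDecomposable H = ∃[ z ] z ∈ V H × Decomposable z H

{-# OPTIONS --safe #-}

-- Since |e| ≤ |f| implies |e ∖ f| ≤ |f ∖ e|, a 1-Sperner hypergraph satisfies
-- |e ∖ f| = 1 whenever e ≠ f and |e| ≤ |f|. Hence H is z-decomposable as soon
-- as |e| ≤ |f| for all hyperedges e, f with z ∈ e ∖ f. If all hyperedges have
-- the same size, every vertex is such a z. Otherwise take m of minimum size, t
-- of maximum size and m ∖ t = {w}: the vertex w works. Indeed, suppose that
-- w ∈ e ∖ f and |f| < |e|. Then m ∖ f = {w} = e ∖ t; write m ∖ e = {x} and
-- f ∖ t = {y}. As x, y ≠ w, we have x ∈ f and y ∉ e, so x = y because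
-- |f ∖ e| = 1; but x ∈ t, whereas y ∉ t.

module Submission where

open import Defs
open import Data.Nat.Base using (ℕ)
open import Data.Fin.Subset using (Nonempty)
open import Data.Product.Base using (_×_; ∃-syntax)

open import Level using (0ℓ)
open import Data.Bool.Properties using () renaming (_≟_ to _≟ᵇ_)
open import Data.Fin.Base using (Fin)
open import Data.Fin.Properties using (_≟_)
open import Data.Fin.Subset
  using (Subset; inside; outside; _∈_; _∉_; _⊆_; _∪_; _∩_; _─_; _-_; ⁅_⁆; ∣_∣; Empty)
open import Data.Fin.Subset.Properties
open import Data.Nat.Base using (suc; _+_; _∸_; _⊓_; _≤_; _<_)
open import Data.Nat.Induction using (<-wellFounded)
open import Data.Nat.Properties
  using (_<?_; ≮⇒≥; <⇒≤; <⇒≱; <-irrefl; ≤-trans; +-suc; +-mono-≤-<; m≤n⇒m⊓n≡m; ∸-monoʳ-<)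
open import Data.Product.Base using (_,_; proj₁)
open import Data.Sum.Base using (inj₁; inj₂; [_,_]′)
open import Data.Vec.Base using ([]; _∷_; here; there; tabulate)
open import Data.Vec.Properties using (≡-dec; lookup⇒[]=; []=⇒lookup; lookup∘tabulate)
open import Function.Base using (_∘_; _$_)
open import Induction.WellFounded using (Acc; acc)
open import Relation.Binary.PropositionalEquality
  using (_≡_; _≢_; refl; sym; trans; cong; subst; subst₂)
open import Relation.Nullary using (¬_; yes; no; does; contradiction; decidable-stable)
open import Relation.Nullary.Decidable using (_×-dec_; dec-true)
open import Relation.Unary using (Pred; Decidable)

private
  variable
    n : ℕ
    x y z : Fin n
    p q r e f m t : Subset n

-- Differences and cardinalities of finite subsets.

x∈p─q⇒x∉q : x ∈ p ─ q → x ∉ q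
x∈p─q⇒x∉q {p = _ ∷ _} {q = inside ∷ _} () here
x∈p─q⇒x∉q {p = _ ∷ _} {q = _ ∷ _} (there x∈p─q) (there x∈q) = x∈p─q⇒x∉q x∈p─q x∈q

x∈p-y⇒x≢y : x ∈ p - y → x ≢ y
x∈p-y⇒x≢y x∈p-y refl = x∈p─q⇒x∉q x∈p-y (x∈⁅x⁆ _)

-- Both sides count the union of `p` and `q`.
∣p∣+∣q─p∣≡∣q∣+∣p─q∣ : ∀ (p q : Subset n) → ∣ p ∣ + ∣ q ─ p ∣ ≡ ∣ q ∣ + ∣ p ─ q ∣
∣p∣+∣q─p∣≡∣q∣+∣p─q∣ [] [] = refl
∣p∣+∣q─p∣≡∣q∣+∣p─q∣ (inside ∷ p) (inside ∷ q) = cong suc (∣p∣+∣q─p∣≡∣q∣+∣p─q∣ p q)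
∣p∣+∣q─p∣≡∣q∣+∣p─q∣ (inside ∷ p) (outside ∷ q) =
  trans (cong suc (∣p∣+∣q─p∣≡∣q∣+∣p─q∣ p q)) (sym (+-suc ∣ q ∣ _))
∣p∣+∣q─p∣≡∣q∣+∣p─q∣ (outside ∷ p) (inside ∷ q) =
  trans (+-suc ∣ p ∣ _) (cong suc (∣p∣+∣q─p∣≡∣q∣+∣p─q∣ p q))
∣p∣+∣q─p∣≡∣q∣+∣p─q∣ (outside ∷ p) (outside ∷ q) = ∣p∣+∣q─p∣≡∣q∣+∣p─q∣ p q

∣p∣≤∣q∣⇒∣p─q∣≤∣q─p∣ : ∀ (p q : Subset n) → ∣ p ∣ ≤ ∣ q ∣ → ∣ p ─ q ∣ ≤ ∣ q ─ p ∣
∣p∣≤∣q∣⇒∣p─q∣≤∣q─p∣ p q ∣p∣≤∣q∣ = ≮⇒≥ λ lt → <-irrefl (∣p∣+∣q─p∣≡∣q∣+∣p─q∣ p q)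
  (+-mono-≤-< ∣p∣≤∣q∣ lt)

∣p∣≡1⇒Nonempty : {p : Subset n} → ∣ p ∣ ≡ 1 → Nonempty p
∣p∣≡1⇒Nonempty {n = n} {p = p} ∣p∣≡1 = decidable-stable (nonempty? p) λ p-empty →
  contradiction (trans (sym ∣p∣≡1) (trans (cong ∣_∣ (Empty-unique p-empty)) (∣⊥∣≡0 n))) λ ()

-- Otherwise `y` would make `⁅ x ⁆` a proper subset of `p`, forcing 1 < 1.
∣p∣≡1⇒unique : ∣ p ∣ ≡ 1 → x ∈ p → y ∈ p → x ≡ y
∣p∣≡1⇒unique {p = p} {x = x} {y = y} ∣p∣≡1 x∈p y∈p =
  decidable-stable (x ≟ y) λ x≢y → <-irrefl (trans (∣⁅x⁆∣≡1 x) (sym ∣p∣≡1)) $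
    p⊂q⇒∣p∣<∣q∣ ((λ u∈⁅x⁆ → subst (_∈ p) (sym (x∈⁅y⁆⇒x≡y x u∈⁅x⁆)) x∈p)
                 , y , y∈p , x≢y⇒x∉⁅y⁆ (x≢y ∘ sym))

p⊆q⇒p∪[q─p]≡q : p ⊆ q → p ∪ (q ─ p) ≡ q
p⊆q⇒p∪[q─p]≡q {p = p} {q = q} p⊆q = ⊆-antisym
  ([ p⊆q , p─q⊆p q p ]′ ∘ x∈p∪q⁻ p (q ─ p)) q⊆
  where
  q⊆ : q ⊆ p ∪ (q ─ p)
  q⊆ {x} x∈q with x ∈? p
  ... | yes x∈p = p⊆p∪q (q ─ p) x∈p
  ... | no  x∉p = q⊆p∪q p (q ─ p) (x∈p∧x∉q⇒x∈p─q x∈q x∉p)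

-- All of `r` is subtracted again, and disjointness ensures that no element of `p` is lost with it.
[r∪p]─[r∪q]≡p─q : Empty (r ∩ p) → (r ∪ p) ─ (r ∪ q) ≡ p ─ q
[r∪p]─[r∪q]≡p─q {r = r} {p = p} {q = q} r∩p-empty = ⊆-antisym to from
  where
  to : (r ∪ p) ─ (r ∪ q) ⊆ p ─ q
  to x∈ with x∈p∪q⁻ r p (p─q⊆p (r ∪ p) (r ∪ q) x∈)
  ... | inj₁ x∈r = contradiction (p⊆p∪q q x∈r) (x∈p─q⇒x∉q x∈)
  ... | inj₂ x∈p = x∈p∧x∉q⇒x∈p─q x∈p (x∈p─q⇒x∉q x∈ ∘ q⊆p∪q r q)

  from : p ─ q ⊆ (r ∪ p) ─ (r ∪ q)
  from x∈ = x∈p∧x∉q⇒x∈p─q (q⊆p∪q r p x∈p)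
    ([ (λ x∈r → r∩p-empty (_ , x∈p∩q⁺ (x∈r , x∈p))) , x∈p─q⇒x∉q x∈ ]′ ∘ x∈p∪q⁻ r q)
    where x∈p = p─q⊆p p q x∈

-- Subsets cut out by decidable predicates, and extremal subsets.

module _ {P : Pred (Fin n) 0ℓ} (P? : Decidable P) where

  comprehension : Subset n
  comprehension = tabulate (does ∘ P?)

  ∈-comprehension⁺ : P x → x ∈ comprehension
  ∈-comprehension⁺ {x} px = lookup⇒[]= x comprehension
    (trans (lookup∘tabulate (does ∘ P?) x) (dec-true (P? x) px))

  ∈-comprehension⁻ : x ∈ comprehension → P x
  ∈-comprehension⁻ {x} x∈
    with P? x | trans (sym (lookup∘tabulate (does ∘ P?) x)) ([]=⇒lookup x∈)
  ... | yes px | _ = px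

module _ {P : Pred (Subset n) 0ℓ} (P? : Decidable P) where

  -- Well-founded descent on the value of `g`: a finite search either yields a strictly better
  -- subset or certifies the current one.
  minimiser : (g : Subset n → ℕ) → P e → ∃[ m ] P m × (∀ {f} → P f → g m ≤ g f)
  minimiser g pe = go pe (<-wellFounded _)
    where
    go : P e → Acc _<_ (g e) → ∃[ m ] P m × (∀ {f} → P f → g m ≤ g f)
    go {e} pe (acc rs) with anySubset? (λ f → P? f ×-dec g f <? g e)
    ... | yes (f , pf , gf<ge) = go pf (rs gf<ge)
    ... | no ∄smaller = e , pe , λ pf → ≮⇒≥ λ gf<ge → ∄smaller (_ , pf , gf<ge)

  smallest : P e → ∃[ m ] P m × (∀ {f} → P f → ∣ m ∣ ≤ ∣ f ∣)
  smallest = minimiser ∣_∣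

  largest : P e → ∃[ t ] P t × (∀ {f} → P f → ∣ f ∣ ≤ ∣ t ∣)
  -- Minimising the size of the complement maximises the size; the bound `∣p∣≤n` keeps truncated
  -- subtraction strictly decreasing.
  largest pe with minimiser (λ f → n ∸ ∣ f ∣) pe
  ... | t , pt , t-min = t , pt , λ {f} pf →
    ≮⇒≥ λ ∣t∣<∣f∣ → <⇒≱ (∸-monoʳ-< ∣t∣<∣f∣ (∣p∣≤n f)) (t-min pf)

-- A decomposing vertex from extremal hyperedges.

module _ {H : Hypergraph n} (sperner : OneSperner H) where

  ∣e∣≤∣f∣⇒∣e─f∣≡1 : Edge H e → Edge H f → e ≢ f → ∣ e ∣ ≤ ∣ f ∣ → ∣ e ─ f ∣ ≡ 1
  ∣e∣≤∣f∣⇒∣e─f∣≡1 {e} {f} e∈E f∈E e≢f ∣e∣≤∣f∣ =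
    trans (sym (m≤n⇒m⊓n≡m (∣p∣≤∣q∣⇒∣p─q∣≤∣q─p∣ e f ∣e∣≤∣f∣))) (sperner e f e∈E f∈E e≢f)

  e─f-Nonempty : Edge H e → Edge H f → e ≢ f → ∣ e ∣ ≤ ∣ f ∣ → ∃[ x ] x ∈ e × x ∉ f
  e─f-Nonempty {e} {f} e∈E f∈E e≢f ∣e∣≤∣f∣
    with ∣p∣≡1⇒Nonempty (∣e∣≤∣f∣⇒∣e─f∣≡1 e∈E f∈E e≢f ∣e∣≤∣f∣)
  ... | x , x∈e─f = x , p─q⊆p e f x∈e─f , x∈p─q⇒x∉q x∈e─f

  -- The point `x` itself shows that `e` and `f` differ, so `e ─ f` is a singleton.
  e─f-unique : Edge H e → Edge H f → ∣ e ∣ ≤ ∣ f ∣ →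
               x ∈ e → x ∉ f → y ∈ e → y ∉ f → x ≡ y
  e─f-unique e∈E f∈E ∣e∣≤∣f∣ x∈e x∉f y∈e y∉f = ∣p∣≡1⇒unique
    (∣e∣≤∣f∣⇒∣e─f∣≡1 e∈E f∈E (λ { refl → x∉f x∈e }) ∣e∣≤∣f∣)
    (x∈p∧x∉q⇒x∈p─q x∈e x∉f) (x∈p∧x∉q⇒x∈p─q y∈e y∉f)

  -- A point of `e - z` outside `f` would be a second element of the singleton `e ─ f`, next to `z`.
  decomposable : (∀ {e f} → Edge H e → Edge H f → z ∈ e → z ∉ f → ∣ e ∣ ≤ ∣ f ∣) →
                 Decomposable z H
  decomposable {z} sizes e f e∈E f∈E z∈e─f {x} x∈e-z = decidable-stable (x ∈? f) λ x∉f →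
    x∈p-y⇒x≢y x∈e-z (e─f-unique e∈E f∈E (sizes e∈E f∈E z∈e z∉f)
      (p─q⊆p e ⁅ z ⁆ x∈e-z) x∉f z∈e z∉f)
    where
    z∈e = p─q⊆p e f z∈e─f
    z∉f = x∈p─q⇒x∉q z∈e─f

  pivot : Edge H m → (∀ {f} → Edge H f → ∣ m ∣ ≤ ∣ f ∣) →
          Edge H t → (∀ {f} → Edge H f → ∣ f ∣ ≤ ∣ t ∣) →
          z ∈ m → z ∉ t →
          Edge H e → Edge H f → z ∈ e → z ∉ f → ∣ e ∣ ≤ ∣ f ∣
  pivot {m = m} {t = t} {z = w} {e = e} {f = f}
        m∈E m-min t∈E t-max w∈m w∉t e∈E f∈E w∈e w∉f = ≮⇒≥ impossible
    where
    impossible : ¬ ∣ f ∣ < ∣ e ∣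
    -- Extremality excludes `m ≡ e` and `f ≡ t`, as either would give |e| ≤ |f|; so both differences
    -- contain a point.
    impossible ∣f∣<∣e∣
      with e─f-Nonempty m∈E e∈E (λ { refl → <⇒≱ ∣f∣<∣e∣ (m-min f∈E) }) (m-min e∈E)
         | e─f-Nonempty f∈E t∈E (λ { refl → <⇒≱ ∣f∣<∣e∣ (t-max e∈E) }) (t-max f∈E)
    ... | x , x∈m , x∉e | y , y∈f , y∉t = y∉t (subst (_∈ t) x≡y x∈t)
      where
      -- If `x` were outside `f`, then `x` and `w` would coincide as points of `m ─ f`, although
      -- only `w` lies in `e`. The next two facts follow the same pattern, with `m ─ t` and `e ─ t`.
      x∈f : x ∈ f
      x∈f = decidable-stable (x ∈? f) λ x∉f → x∉e
        (subst (_∈ e) (e─f-unique m∈E f∈E (m-min f∈E) w∈m w∉f x∈m x∉f) w∈e)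

      x∈t : x ∈ t
      x∈t = decidable-stable (x ∈? t) λ x∉t → x∉e
        (subst (_∈ e) (e─f-unique m∈E t∈E (m-min t∈E) w∈m w∉t x∈m x∉t) w∈e)

      y∉e : y ∉ e
      y∉e y∈e = w∉f
        (subst (_∈ f) (e─f-unique e∈E t∈E (t-max e∈E) y∈e y∉t w∈e w∉t) y∈f)

      x≡y : x ≡ y
      x≡y = e─f-unique f∈E e∈E (<⇒≤ ∣f∣<∣e∣) x∈f x∉e y∈f y∉e

  oneDecomposable : Nonempty (V H) → OneDecomposable H
  oneDecomposable (v , v∈V) with anySubset? (Edge? H)
  -- Without hyperedges the condition is vacuous at any vertex.
  ... | no ∄edge = v , v∈V , λ e f e∈E → contradiction (e , e∈E) ∄edge
  ... | yes (_ , e∈E) with smallest (Edge? H) e∈E | largest (Edge? H) e∈E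
  ... | m , m∈E , m-min | t , t∈E , t-max with ≡-dec _≟ᵇ_ m t
  -- Here the least and greatest sizes agree, so |e| ≤ |t| = |m| ≤ |f|.
  ... | yes refl = v , v∈V , decomposable λ e∈E f∈E _ _ → ≤-trans (t-max e∈E) (m-min f∈E)
  ... | no m≢t with e─f-Nonempty m∈E t∈E m≢t (m-min t∈E)
  ... | w , w∈m , w∉t =
    w , Edge⇒⊆V H m∈E w∈m , decomposable (pivot m∈E m-min t∈E t-max w∈m w∉t)

-- Reconstructing the gluing at a decomposing vertex.

link : Subset n → Subset n → Hypergraph n → Hypergraph n
link A W H = record
  { V       = W
  ; Edge    = λ e → e ⊆ W × Edge H (A ∪ e)
  ; Edge?   = λ e → (e ⊆? W) ×-dec Edge? H (A ∪ e)
  ; Edge⇒⊆V = proj₁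
  }

-- Adding the disjoint set `A` to two subsets of `W` preserves both differences and keeps the
-- subsets distinct, so the condition is inherited from `H`.
link-OneSperner : ∀ (H : Hypergraph n) {A W} → Empty (A ∩ W) →
                  OneSperner H → OneSperner (link A W H)
link-OneSperner H {A} {W} A∩W-empty sperner e f (e⊆W , A∪e∈E) (f⊆W , A∪f∈E) e≢f =
  subst₂ (λ p q → ∣ p ∣ ⊓ ∣ q ∣ ≡ 1) e-diff f-diff
    (sperner (A ∪ e) (A ∪ f) A∪e∈E A∪f∈E A∪e≢A∪f)
  where
  disjoint : p ⊆ W → Empty (A ∩ p)
  disjoint {p = p} p⊆W (x , x∈A∩p) with x∈p∩q⁻ A p x∈A∩p
  ... | x∈A , x∈p = A∩W-empty (x , x∈p∩q⁺ (x∈A , p⊆W x∈p))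

  e-diff : (A ∪ e) ─ (A ∪ f) ≡ e ─ f
  e-diff = [r∪p]─[r∪q]≡p─q (disjoint e⊆W)

  f-diff : (A ∪ f) ─ (A ∪ e) ≡ f ─ e
  f-diff = [r∪p]─[r∪q]≡p─q (disjoint f⊆W)

  cancel : p ⊆ W → A ∪ p ⊆ A ∪ q → p ⊆ q
  cancel {p = p} {q = q} p⊆W A∪p⊆A∪q x∈p with x∈p∪q⁻ A q (A∪p⊆A∪q (q⊆p∪q A p x∈p))
  ... | inj₁ x∈A = contradiction (_ , x∈p∩q⁺ (x∈A , p⊆W x∈p)) A∩W-empty
  ... | inj₂ x∈q = x∈q

  A∪e≢A∪f : A ∪ e ≢ A ∪ f
  A∪e≢A∪f eq = e≢f (⊆-antisym (cancel e⊆W (⊆-reflexive eq))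
                              (cancel f⊆W (⊆-reflexive (sym eq))))

module _ (H : Hypergraph n) (z : Fin n) (z∈V : z ∈ V H) (dec : Decomposable z H) where

  private
    -- `V₁` has to contain `e - z` for each hyperedge `e` through `z`; the union of these sets is
    -- the smallest choice.
    Covered : Pred (Fin n) 0ℓ
    Covered x = ∃[ e ] Edge H e × z ∈ e × x ∈ e - z

    Covered? : Decidable Covered
    Covered? x = anySubset? λ e → Edge? H e ×-dec z ∈? e ×-dec x ∈? (e - z)

    V₁ V₂ : Subset n
    V₁ = comprehension Covered?
    V₂ = V H ─ (V₁ ∪ ⁅ z ⁆)

    z∉V₁ : z ∉ V₁
    z∉V₁ z∈V₁ with ∈-comprehension⁻ Covered? z∈V₁
    ... | _ , _ , _ , z∈e-z = x∈p-y⇒x≢y z∈e-z refl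

    z∉V₂ : z ∉ V₂
    z∉V₂ z∈V₂ = x∈p─q⇒x∉q z∈V₂ (q⊆p∪q V₁ ⁅ z ⁆ (x∈⁅x⁆ z))

    e-z⊆V₁ : Edge H e → z ∈ e → e - z ⊆ V₁
    e-z⊆V₁ e∈E z∈e x∈e-z = ∈-comprehension⁺ Covered? (_ , e∈E , z∈e , x∈e-z)

    -- This is where decomposability enters: each point of `V₁` lies in some `e - z` with `z` in
    -- `e ─ f`.
    V₁⊆f : Edge H f → z ∉ f → V₁ ⊆ f
    V₁⊆f f∈E z∉f x∈V₁ with ∈-comprehension⁻ Covered? x∈V₁
    ... | e , e∈E , z∈e , x∈e-z = dec e _ e∈E f∈E (x∈p∧x∉q⇒x∈p─q z∈e z∉f) x∈e-z

    V₁⊆V : V₁ ⊆ V H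
    V₁⊆V x∈V₁ with ∈-comprehension⁻ Covered? x∈V₁
    ... | e , e∈E , _ , x∈e-z = Edge⇒⊆V H e∈E (p─q⊆p e ⁅ z ⁆ x∈e-z)

    f─V₁⊆V₂ : Edge H f → z ∉ f → f ─ V₁ ⊆ V₂
    f─V₁⊆V₂ {f} f∈E z∉f x∈f─V₁ = x∈p∧x∉q⇒x∈p─q (Edge⇒⊆V H f∈E x∈f)
      ([ x∈p─q⇒x∉q x∈f─V₁ , (λ x∈⁅z⁆ → z∉f (subst (_∈ f) (x∈⁅y⁆⇒x≡y z x∈⁅z⁆) x∈f)) ]′
        ∘ x∈p∪q⁻ V₁ ⁅ z ⁆)
      where x∈f = p─q⊆p f V₁ x∈f─V₁

    ⁅z⁆⊆ : z ∈ p → ⁅ z ⁆ ⊆ p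
    ⁅z⁆⊆ {p = p} z∈p x∈⁅z⁆ = subst (_∈ p) (sym (x∈⁅y⁆⇒x≡y z x∈⁅z⁆)) z∈p

    ⁅z⁆∩V₁-empty : Empty (⁅ z ⁆ ∩ V₁)
    ⁅z⁆∩V₁-empty (x , x∈) with x∈p∩q⁻ ⁅ z ⁆ V₁ x∈
    ... | x∈⁅z⁆ , x∈V₁ = z∉V₁ (subst (_∈ V₁) (x∈⁅y⁆⇒x≡y z x∈⁅z⁆) x∈V₁)

    V₁∩V₂-empty : Empty (V₁ ∩ V₂)
    V₁∩V₂-empty (x , x∈) with x∈p∩q⁻ V₁ V₂ x∈
    ... | x∈V₁ , x∈V₂ = x∈p─q⇒x∉q x∈V₂ (p⊆p∪q ⁅ z ⁆ x∈V₁)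

    H₁ H₂ : Hypergraph n
    H₁ = link ⁅ z ⁆ V₁ H
    H₂ = link V₁ V₂ H

    V≡V₁∪V₂∪⁅z⁆ : V H ≡ V₁ ∪ V₂ ∪ ⁅ z ⁆
    V≡V₁∪V₂∪⁅z⁆ = ⊆-antisym to from
      where
      to : V H ⊆ V₁ ∪ V₂ ∪ ⁅ z ⁆
      to {x} x∈V with x ∈? V₁ ∪ ⁅ z ⁆
      ... | no x∉ = q⊆p∪q V₁ _ (p⊆p∪q ⁅ z ⁆ (x∈p∧x∉q⇒x∈p─q x∈V x∉))
      ... | yes x∈ = [ p⊆p∪q _ , q⊆p∪q V₁ _ ∘ q⊆p∪q V₂ ⁅ z ⁆ ]′ (x∈p∪q⁻ V₁ ⁅ z ⁆ x∈)

      from : V₁ ∪ V₂ ∪ ⁅ z ⁆ ⊆ V H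
      from = [ V₁⊆V , [ p─q⊆p (V H) _ , ⁅z⁆⊆ z∈V ]′ ∘ x∈p∪q⁻ V₂ ⁅ z ⁆ ]′ ∘ x∈p∪q⁻ V₁ _

    -- A hyperedge through `z` comes from `H₁` by adding `z` back; one avoiding `z` contains `V₁`
    -- and comes from `H₂` by adding `V₁` back.
    split : Edge H f → Edge (glue z H₁ H₂) f
    split {f} f∈E with z ∈? f
    ... | yes z∈f = inj₁ (f - z , (e-z⊆V₁ f∈E z∈f , subst (Edge H) (sym eq) f∈E) , sym eq)
      where eq = p⊆q⇒p∪[q─p]≡q (⁅z⁆⊆ z∈f)
    ... | no z∉f = inj₂ (f ─ V₁ , (f─V₁⊆V₂ f∈E z∉f , subst (Edge H) (sym eq) f∈E) , sym eq)
      where eq = p⊆q⇒p∪[q─p]≡q (V₁⊆f f∈E z∉f)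

    -- Each hyperedge of a link carries the proof that its union with `A` is a hyperedge of `H`.
    merge : Edge (glue z H₁ H₂) f → Edge H f
    merge (inj₁ (_ , (_ , e∈E) , refl)) = e∈E
    merge (inj₂ (_ , (_ , e∈E) , refl)) = e∈E

  gluing : OneSperner H →
           ∃[ H₁ ] ∃[ H₂ ] OneSperner H₁ × OneSperner H₂ × Gluable z H₁ H₂ × H ≈ glue z H₁ H₂
  gluing sperner = H₁ , H₂
    , link-OneSperner H ⁅z⁆∩V₁-empty sperner
    , link-OneSperner H V₁∩V₂-empty sperner
    , (V₁∩V₂-empty , [ z∉V₁ , z∉V₂ ]′ ∘ x∈p∪q⁻ V₁ V₂)
    , V≡V₁∪V₂∪⁅z⁆ , split , merge

theorem9 : ∀ (n : ℕ) (H : Hypergraph n) → OneSperner H → Nonempty (V H) →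
    OneDecomposable H ×
    (∃[ z ] ∃[ H₁ ] ∃[ H₂ ]
    OneSperner H₁ × OneSperner H₂ × Gluable z H₁ H₂ × H ≈ glue z H₁ H₂)
theorem9 n H sperner V≢∅ with oneDecomposable {H = H} sperner V≢∅
... | z , z∈V , dec = (z , z∈V , dec) , z , gluing H z z∈V dec sperner
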